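{- Let $\sigma$ be a connected non-crossing partition and let $\tau=1[\rho]$ for some non-crossing partition $\rho$. If $\sigma$ and $\tau$ are nc-equivalent, then $1[\sigma]$ and $\tau1=1[\rho]1$ are nc-equivalent.
   Context: Set partitions are written in canonical sequential form (restricted growth words). Pattern containment means having a subsequence order-isomorphic to the pattern; a partition is non-crossing if it avoids $1212$. Bracket notation: in a word built from letters and bracketed partitions, $[\sigma]$ stands for $\sigma+r$ (add $r$ to every letter), where $r$ is the number of distinct symbols appearing before it; so $1[\rho]$ is $1$ followed by $\rho+1$, and $1[\rho]1$ appends a final $1$. $\alpha[\beta]$ is $\alpha$ followed by $\beta$ shifted by the number of blocks of $\alpha$; a partition is connected if it cannot be written as $\alpha[\beta]$ with $\alpha,\beta$ nonempty. Patterns $\alpha,\beta$ are nc-equivalent if for every $n\ge0$ the number of partitions of $[n]$ avoiding $1212$ and $\alpha$ equals the number avoiding $1212$ and $\beta$. -}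

module Defs where

open import Data.Fin.Base using (Fin; cast)
open import Data.Fin.Properties using (all?)
open import Data.List.Base using (List; []; _∷_; [_]; _++_; map; concatMap; applyUpTo; length; lookup; filter; deduplicate)
open import Data.List.Membership.Propositional using (_∈_; find; lose)
open import Data.List.Membership.Propositional.Properties using (∈-map⁺; ∈-map⁻; ∈-++⁺ˡ; ∈-++⁺ʳ; ∈-++⁻; ∈-concatMap⁺; ∈-concatMap⁻; ∈-applyUpTo⁺; ∈-applyUpTo⁻)
open import Data.List.Properties using (∷-injectiveˡ; ∷-injectiveʳ)
open import Data.List.Relation.Binary.Disjoint.Propositional using (Disjoint)
open import Data.List.Relation.Binary.Sublist.Propositional using (_⊆_; []; _∷_; _∷ʳ_)
open import Data.List.Relation.Unary.All using ([]; universal)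
import Data.List.Relation.Unary.All.Properties as All
open import Data.List.Relation.Unary.AllPairs using ([]; _∷_)
import Data.List.Relation.Unary.AllPairs as AllPairs
import Data.List.Relation.Unary.AllPairs.Properties as AllPairs
open import Data.List.Relation.Unary.Any using (here; any?)
open import Data.List.Relation.Unary.Unique.Propositional using (Unique)
import Data.List.Relation.Unary.Unique.Propositional.Properties as Unique
open import Data.Nat.Base using (ℕ; zero; suc; _+_; _≤_; _<_; _⊔_; z≤n; s≤s)
open import Data.Nat.Properties using (_≟_; _<?_; suc-injective; <⇒≢)
open import Data.Product.Base using (Σ; ∃-syntax; _×_; _,_; proj₁; proj₂)
open import Data.Sum.Base using (inj₁; inj₂)
open import Function.Base using (_∘_)
open import Function.Bundles using (_⇔_; mk⇔; Equivalence)
open import Relation.Binary.PropositionalEquality using (_≡_; _≢_; refl; sym; trans; cong)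
open import Relation.Nullary using (¬_; Dec; yes; no)
open import Relation.Nullary.Decidable using (map′; ¬?; _×-dec_; _→-dec_)

Word : Set
Word = List ℕ

-- Growth m w : w can follow a prefix of a restricted growth word whose maximal
-- letter is m.  Letters start at 1, so m = 0 is the empty prefix.
data Growth (m : ℕ) : Word → Set where
  []  : Growth m []
  _∷_ : ∀ {x w} → 1 ≤ x × x ≤ suc m → Growth (m ⊔ x) w → Growth m (x ∷ w)

-- A partition of [n] is a restricted growth word of length n; its i-th letter
-- is the index of the block of i, with blocks ordered by their minima.
-- The empty word is the partition of the empty set.
IsPartition : Word → Set
IsPartition = Growth 0

OrderIsomorphic : Word → Word → Set
OrderIsomorphic u v = Σ (length u ≡ length v) λ eq → ∀ i j →
  lookup u i < lookup u j ⇔ lookup v (cast eq i) < lookup v (cast eq j)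

Contains : Word → Word → Set
Contains w p = ∃[ s ] s ⊆ w × OrderIsomorphic s p

Avoids : Word → Word → Set
Avoids w p = ¬ Contains w p

NonCrossing : Word → Set
NonCrossing w = Avoids w (1 ∷ 2 ∷ 1 ∷ 2 ∷ [])

symbols : Word → ℕ
symbols w = length (deduplicate _≟_ w)

_⟦_⟧ : Word → Word → Word
α ⟦ β ⟧ = α ++ map (symbols α +_) β

𝟏 : Word
𝟏 = [ 1 ]

Connected : Word → Set
Connected σ = ¬ (∃[ α ] ∃[ β ]
  IsPartition α × IsPartition β × α ≢ [] × β ≢ [] × σ ≡ α ⟦ β ⟧)

growths : ℕ → ℕ → List Word
growths m zero    = [ [] ]
growths m (suc n) = concatMap (λ x → map (x ∷_) (growths (m ⊔ x) n)) (applyUpTo suc (suc m))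

partitions : ℕ → List Word
partitions = growths 0

subwords : Word → List Word
subwords []      = [ [] ]
subwords (x ∷ w) = map (x ∷_) (subwords w) ++ subwords w

∈-subwords⁺ : ∀ {s w} → s ⊆ w → s ∈ subwords w
∈-subwords⁺ []         = here refl
∈-subwords⁺ (y ∷ʳ p)   = ∈-++⁺ʳ _ (∈-subwords⁺ p)
∈-subwords⁺ (refl ∷ p) = ∈-++⁺ˡ (∈-map⁺ _ (∈-subwords⁺ p))

∈-subwords⁻ : ∀ {s} w → s ∈ subwords w → s ⊆ w
∈-subwords⁻ []      (here refl) = []
∈-subwords⁻ (x ∷ w) s∈ with ∈-++⁻ (map (x ∷_) (subwords w)) s∈
... | inj₂ q = x ∷ʳ ∈-subwords⁻ w q
... | inj₁ q with ∈-map⁻ _ q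
...   | _ , r , refl = refl ∷ ∈-subwords⁻ w r

orderIsomorphic? : ∀ u v → Dec (OrderIsomorphic u v)
orderIsomorphic? u v with length u ≟ length v
... | no neq = no (neq ∘ proj₁)
... | yes eq = map′ (eq ,_) proj₂
  (all? λ i → all? λ j →
    (lookup u i <? lookup u j) ⇔-dec (lookup v (cast eq i) <? lookup v (cast eq j)))
  where
  _⇔-dec_ : ∀ {A B : Set} → Dec A → Dec B → Dec (A ⇔ B)
  a ⇔-dec b = map′ (λ (f , g) → mk⇔ f g) (λ e → Equivalence.to e , Equivalence.from e)
    ((a →-dec b) ×-dec (b →-dec a))

contains? : ∀ w p → Dec (Contains w p)
contains? w p = map′
  (λ a → let s , s∈ , iso = find a in s , ∈-subwords⁻ w s∈ , iso)
  (λ (s , s⊆w , iso) → lose (∈-subwords⁺ s⊆w) iso)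
  (any? (λ s → orderIsomorphic? s p) (subwords w))

avoids? : ∀ w p → Dec (Avoids w p)
avoids? w p = ¬? (contains? w p)

nonCrossing? : ∀ w → Dec (NonCrossing w)
nonCrossing? w = avoids? w (1 ∷ 2 ∷ 1 ∷ 2 ∷ [])

ncAvoiders : ℕ → Word → List Word
ncAvoiders n p = filter (λ w → nonCrossing? w ×-dec avoids? w p) (partitions n)

NcEquivalent : Word → Word → Set
NcEquivalent α β = ∀ n → length (ncAvoiders n α) ≡ length (ncAvoiders n β)

-- The list partitions n has each partition of [n] exactly once, so that
-- length (ncAvoiders n p) is the number of non-crossing partitions of [n]
-- avoiding p.

∈-growths⁺ : ∀ {m w} → Growth m w → w ∈ growths m (length w)
∈-growths⁺ []                       = here refl
∈-growths⁺ ((s≤s z≤n , x≤1+m) ∷ g) =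
  ∈-concatMap⁺ _ (lose (∈-applyUpTo⁺ suc x≤1+m) (∈-map⁺ _ (∈-growths⁺ g)))

∈-growths⁻ : ∀ m n {w} → w ∈ growths m n → Growth m w × length w ≡ n
∈-growths⁻ m zero    (here refl) = [] , refl
∈-growths⁻ m (suc n) w∈
  with _ , x∈ , q ← find (∈-concatMap⁻ (λ x → map (x ∷_) (growths (m ⊔ x) n)) {xs = applyUpTo suc (suc m)} w∈)
  with _ , r , refl ← ∈-map⁻ _ q
  with _ , i<1+m , refl ← ∈-applyUpTo⁻ suc x∈
  with g , eq ← ∈-growths⁻ _ n r
  = (s≤s z≤n , i<1+m) ∷ g , cong suc eq

∈-partitions : ∀ {n w} → w ∈ partitions n ⇔ (IsPartition w × length w ≡ n)
∈-partitions = mk⇔ (∈-growths⁻ 0 _) λ { (g , refl) → ∈-growths⁺ g }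

growths-unique : ∀ m n → Unique (growths m n)
growths-unique m zero    = [] ∷ []
growths-unique m (suc n) = Unique.concat⁺
  (All.map⁺ (universal (λ x → Unique.map⁺ ∷-injectiveʳ (growths-unique (m ⊔ x) n)) _))
  (AllPairs.map⁺ (AllPairs.map disjoint
    (Unique.applyUpTo⁺₁ suc (suc m) (λ i<j _ → <⇒≢ i<j ∘ suc-injective))))
  where
  disjoint : ∀ {x y} → x ≢ y →
             Disjoint (map (x ∷_) (growths (m ⊔ x) n)) (map (y ∷_) (growths (m ⊔ y) n))
  disjoint x≢y (p , q) with _ , _ , eq ← ∈-map⁻ _ p | _ , _ , eq′ ← ∈-map⁻ _ q =
    x≢y (∷-injectiveˡ (trans (sym eq) eq′))

partitions-unique : ∀ n → Unique (partitions n)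
partitions-unique = growths-unique 0

{-# OPTIONS --safe #-}

-- Cutting at the last 1 writes a nonempty non-crossing partition uniquely as u1[π] with u, π
-- non-crossing partitions, since a letter common to u and π would give a crossing 1x1x.
-- As σ is connected, u1[π] avoids 1[σ] iff u avoids 1[σ] and π avoids σ; and it avoids
-- 1[ρ]1 iff u avoids τ = 1[ρ] and π avoids 1[ρ]1.  Hence, writing a(n), b(n), c(n), d(n) for the
-- numbers of avoiders of σ, τ, 1[σ], τ1, we have c(n+1) = Σ c(i) a(n-i) and
-- d(n+1) = Σ b(i) d(n-i), and a = b forces c = d.

module Submission where

open import Data.Fin.Base using (Fin; zero; suc; cast)
open import Data.Fin.Properties using (cast-is-id)
open import Data.List.Base using (List; []; _∷_; [_]; _++_; map; concatMap; applyUpTo; upTo; applyDownFrom; length; lookup; foldl; tabulate; reverse; deduplicate; cartesianProduct)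
open import Data.List.Membership.Propositional using (_∈_; _∉_; find; lose)
open import Data.List.Membership.Propositional.Properties
open import Data.List.Membership.Propositional.Properties.WithK using (unique∧set⇒bag)
open import Data.List.Properties
open import Data.List.Relation.Binary.BagAndSetEquality using (∼bag⇒↭)
open import Data.List.Relation.Binary.Disjoint.Propositional using (Disjoint)
open import Data.List.Relation.Binary.Permutation.Propositional.Properties using (↭-length; ↭-reverse)
open import Data.List.Relation.Binary.Sublist.Propositional using (_⊆_; []; _∷_; _∷ʳ_; ⊆-refl; ⊆-trans; minimum; from∈)
  renaming (lookup to ⊆-lookup)
import Data.List.Relation.Binary.Sublist.Propositional.Properties as Sublist
open import Data.List.Relation.Unary.All using ([]; _∷_; universal)
import Data.List.Relation.Unary.All as All
import Data.List.Relation.Unary.All.Properties as All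
open import Data.List.Relation.Unary.AllPairs using ([]; _∷_)
import Data.List.Relation.Unary.AllPairs as AllPairs
import Data.List.Relation.Unary.AllPairs.Properties as AllPairs
open import Data.List.Relation.Unary.Any using (here; there)
open import Data.List.Relation.Unary.Unique.Propositional using (Unique)
import Data.List.Relation.Unary.Unique.Propositional.Properties as Unique
open import Data.List.Relation.Unary.Unique.DecPropositional.Properties using (deduplicate-!)
open import Data.Nat.Base
open import Data.Nat.Induction using (<-rec)
open import Data.Nat.ListAction using (sum)
open import Data.Nat.ListAction.Properties using (sum-↭)
open import Data.Nat.Properties
open import Data.Product.Base using (∃-syntax; _×_; _,_; proj₁; proj₂; uncurry)
import Data.Product.Base as Product
open import Data.Sum.Base using (_⊎_; inj₁; inj₂)
import Data.Sum.Base as Sum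
open import Function.Base using (_∘_)
open import Function.Bundles using (_⇔_; mk⇔; Equivalence)
open import Relation.Binary.PropositionalEquality hiding ([_])
open import Relation.Nullary using (¬_; yes; no; contradiction)
open import Relation.Nullary.Decidable using (_×-dec_)
open import Data.List.Membership.DecPropositional _≟_ using (_∈?_)
open import Defs

open Equivalence using (to; from)

-- Counting with lists

Unique∧⇔⇒length≡ : ∀ {A : Set} {xs ys : List A} → Unique xs → Unique ys →
  (∀ {x} → x ∈ xs ⇔ x ∈ ys) → length xs ≡ length ys
Unique∧⇔⇒length≡ xs! ys! eq = ↭-length (∼bag⇒↭ (unique∧set⇒bag xs! ys! eq))

-- Injectivity is asked only on members of the list because `join` is injective on pairs of
-- partitions but not on arbitrary pairs of words.
Unique-map : ∀ {A B : Set} {f : A → B} {xs} →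
  (∀ {x y} → x ∈ xs → y ∈ xs → f x ≡ f y → x ≡ y) → Unique xs → Unique (map f xs)
Unique-map inj []         = []
Unique-map inj (x∉ ∷ xs!) =
  All.map⁺ (All.tabulate λ y∈ fx≡fy → All.lookup x∉ y∈ (inj (here refl) (there y∈) fx≡fy)) ∷
  Unique-map (λ x∈ y∈ → inj (there x∈) (there y∈)) xs!

length-concatMap : ∀ {A B : Set} (f : A → List B) xs →
  length (concatMap f xs) ≡ sum (map (length ∘ f) xs)
length-concatMap f []       = refl
length-concatMap f (x ∷ xs) =
  trans (length-++ (f x)) (cong (length (f x) +_) (length-concatMap f xs))

length-cartesianProduct : ∀ {A B : Set} (xs : List A) (ys : List B) →
  length (cartesianProduct xs ys) ≡ length xs * length ys
length-cartesianProduct []       ys = refl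
length-cartesianProduct (x ∷ xs) ys = trans (length-++ (map (x ,_) ys))
  (cong₂ _+_ (length-map (x ,_) ys) (length-cartesianProduct xs ys))

applyDownFrom≡applyUpTo : ∀ {A : Set} (f : ℕ → A) n →
  applyDownFrom f (suc n) ≡ applyUpTo (λ i → f (n ∸ i)) (suc n)
applyDownFrom≡applyUpTo f zero    = refl
applyDownFrom≡applyUpTo f (suc n) = cong (f (suc n) ∷_) (applyDownFrom≡applyUpTo f n)

-- Needed because the two convolutions to be compared carry their recursive factor on opposite
-- sides.
sum-upTo-reverse : ∀ (f : ℕ → ℕ) n →
  sum (map f (upTo (suc n))) ≡ sum (map (λ i → f (n ∸ i)) (upTo (suc n)))
sum-upTo-reverse f n = begin
  sum (map f (upTo (suc n)))                     ≡⟨ cong sum (map-upTo f (suc n)) ⟩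
  sum (applyUpTo f (suc n))                      ≡⟨ sum-↭ (↭-reverse (applyUpTo f (suc n))) ⟨
  sum (reverse (applyUpTo f (suc n)))            ≡⟨ cong sum (reverse-applyUpTo f (suc n)) ⟩
  sum (applyDownFrom f (suc n))                  ≡⟨ cong sum (applyDownFrom≡applyUpTo f n) ⟩
  sum (applyUpTo (λ i → f (n ∸ i)) (suc n))      ≡⟨ cong sum (map-upTo (λ i → f (n ∸ i)) (suc n)) ⟨
  sum (map (λ i → f (n ∸ i)) (upTo (suc n)))     ∎
  where open ≡-Reasoning

-- Restricted growth words

growth-positive : ∀ {m w x} → Growth m w → x ∈ w → 1 ≤ x
growth-positive ((1≤x , _) ∷ _) (here refl) = 1≤x
growth-positive (_ ∷ g)         (there x∈)  = growth-positive g x∈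

-- `foldl _⊔_ m w` is the value that the index of `Growth m` reaches after all of `w` has been read.
≤-foldl-⊔ : ∀ m w → m ≤ foldl _⊔_ m w
≤-foldl-⊔ m []      = ≤-refl
≤-foldl-⊔ m (x ∷ w) = ≤-trans (m≤m⊔n m x) (≤-foldl-⊔ (m ⊔ x) w)

∈⇒≤-foldl-⊔ : ∀ m {w x} → x ∈ w → x ≤ foldl _⊔_ m w
∈⇒≤-foldl-⊔ m {y ∷ w} (here refl) = ≤-trans (m≤n⊔m m y) (≤-foldl-⊔ (m ⊔ y) w)
∈⇒≤-foldl-⊔ m {y ∷ w} (there x∈)  = ∈⇒≤-foldl-⊔ (m ⊔ y) x∈

-- The running maximum rises by at most one per letter, so it cannot skip `x`: the letter that first
-- lifts it to `x` is `x` itself.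
growth-surjective : ∀ {m w x} → Growth m w → m < x → x ≤ foldl _⊔_ m w → x ∈ w
growth-surjective []                            m<x x≤ = contradiction m<x (≤⇒≯ x≤)
growth-surjective {m} {x = x} (_∷_ {y} (_ , y≤) g) m<x x≤ with x ≤? m ⊔ y
... | no  x≰ = there (growth-surjective g (≰⇒> x≰) x≤)
... | yes x≤m⊔y with ≤-total m y
...   | inj₁ m≤y = here (≤-antisym (≤-trans x≤m⊔y (≤-reflexive (m≤n⇒m⊔n≡n m≤y))) (≤-trans y≤ m<x))
...   | inj₂ y≤m = contradiction m<x (≤⇒≯ (≤-trans x≤m⊔y (≤-reflexive (m≥n⇒m⊔n≡m y≤m))))

growth-++⁺ : ∀ {m u v} → Growth m u → Growth (foldl _⊔_ m u) v → Growth m (u ++ v)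
growth-++⁺ []      h = h
growth-++⁺ (b ∷ g) h = b ∷ growth-++⁺ g h

growth-++⁻ : ∀ {m} u {v} → Growth m (u ++ v) → Growth m u × Growth (foldl _⊔_ m u) v
growth-++⁻ []      g       = [] , g
growth-++⁻ (x ∷ u) (b ∷ g) = Product.map₁ (b ∷_) (growth-++⁻ u g)

growth-map⁺ : ∀ k {m w} → Growth m w → Growth (k + m) (map (k +_) w)
growth-map⁺ k []                              = []
growth-map⁺ k {m} (_∷_ {x} {w} (1≤x , x≤) g) =
  (≤-trans 1≤x (m≤n+m x k) , ≤-trans (+-monoʳ-≤ k x≤) (≤-reflexive (+-suc k m))) ∷
  subst (λ l → Growth l (map (k +_) w)) (+-distribˡ-⊔ k m x) (growth-map⁺ k g)

-- `Growth (k + m)` also lets letters up to `k` recur. With every letter above `k`, the amount `k`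
-- can be subtracted throughout.
growth-map⁻ : ∀ k m {v} → Growth (k + m) v → (∀ {x} → x ∈ v → k < x) →
  ∃[ w ] Growth m w × v ≡ map (k +_) w
growth-map⁻ k m []                        k<v = [] , [] , refl
growth-map⁻ k m (_∷_ {x} {v} (1≤x , x≤) g) k<v
  with z , refl ← m≤n⇒∃[o]m+o≡n (<⇒≤ (k<v (here refl)))
  with w , h , refl ← growth-map⁻ k (m ⊔ z)
         (subst (λ l → Growth l v) (sym (+-distribˡ-⊔ k m z)) g) (k<v ∘ there)
  = z ∷ w
  , (+-cancelˡ-< k 0 z (≤-trans (≤-reflexive (cong suc (+-identityʳ k))) (k<v (here refl)))
    , +-cancelˡ-≤ k z (suc m) (≤-trans x≤ (≤-reflexive (sym (+-suc k m))))) ∷ h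
  , refl

-- The letters of a partition are exactly 1 up to its maximum. This reconciles the shift in `_⟦_⟧`,
-- which counts distinct letters, with `Growth`, which tracks the maximum.
symbols≡maximum : ∀ {w} → IsPartition w → symbols w ≡ foldl _⊔_ 0 w
symbols≡maximum {w} g = trans
  (Unique∧⇔⇒length≡ (deduplicate-! _≟_ w)
    (Unique.applyUpTo⁺₁ suc (foldl _⊔_ 0 w) (λ i<j _ → <⇒≢ i<j ∘ suc-injective))
    (mk⇔ forward backward))
  (length-applyUpTo suc (foldl _⊔_ 0 w))
  where
  forward : ∀ {x} → x ∈ deduplicate _≟_ w → x ∈ applyUpTo suc (foldl _⊔_ 0 w)
  forward x∈ with x∈w ← ∈-deduplicate⁻ _≟_ w x∈ with growth-positive g x∈w
  ... | s≤s z≤n = ∈-applyUpTo⁺ suc (∈⇒≤-foldl-⊔ 0 x∈w)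
  backward : ∀ {x} → x ∈ applyUpTo suc (foldl _⊔_ 0 w) → x ∈ deduplicate _≟_ w
  backward x∈ with _ , i< , refl ← ∈-applyUpTo⁻ suc x∈ =
    ∈-deduplicate⁺ _≟_ (growth-surjective g (s≤s z≤n) i<)

∈⇒≤symbols : ∀ {w x} → IsPartition w → x ∈ w → x ≤ symbols w
∈⇒≤symbols g x∈ = ≤-trans (∈⇒≤-foldl-⊔ 0 x∈) (≤-reflexive (sym (symbols≡maximum g)))

≤symbols⇒∈ : ∀ {w x} → IsPartition w → 1 ≤ x → x ≤ symbols w → x ∈ w
≤symbols⇒∈ g 1≤x x≤ = growth-surjective g 1≤x (≤-trans x≤ (≤-reflexive (symbols≡maximum g)))

partition-++⁻ : ∀ u {v} → IsPartition (u ++ v) → IsPartition u × Growth (symbols u) v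
partition-++⁻ u {v} g with h , h′ ← growth-++⁻ u g =
  h , subst (λ l → Growth l v) (sym (symbols≡maximum h)) h′

partition-unshift : ∀ k {v} → Growth k v → (∀ {x} → x ∈ v → k < x) →
  ∃[ w ] IsPartition w × v ≡ map (k +_) w
partition-unshift k {v} g = growth-map⁻ k 0 (subst (λ l → Growth l v) (sym (+-identityʳ k)) g)

⟦⟧-partition : ∀ {α β} → IsPartition α → IsPartition β → IsPartition (α ⟦ β ⟧)
⟦⟧-partition {α} {β} g h = growth-++⁺ g (subst (λ l → Growth l (map (symbols α +_) β))
  (trans (+-identityʳ (symbols α)) (symbols≡maximum g)) (growth-map⁺ (symbols α) h))

++𝟏-partition : ∀ {u} → IsPartition u → IsPartition (u ++ 𝟏)
++𝟏-partition g = growth-++⁺ g ((s≤s z≤n , s≤s z≤n) ∷ [])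

-- Pattern occurrences

-- Quantifying over members instead of positions makes the order and multiplicity of the pairs
-- irrelevant, so a repeated pair needs no further check.
Aligned : List (ℕ × ℕ) → Set
Aligned zs = ∀ {a b} → a ∈ zs → b ∈ zs → proj₁ a < proj₁ b ⇔ proj₂ a < proj₂ b

-- An occurrence is kept as the list of pairs (letter of the text , letter of the pattern).
Occurs : Word → Word → Set
Occurs w p = ∃[ zs ] map proj₁ zs ⊆ w × map proj₂ zs ≡ p × Aligned zs

contains⇒occurs : ∀ {w p} → Contains w p → Occurs w p
contains⇒occurs {w} {p} (s , s⊆w , eq , iso) =
  tabulate pair ,
  subst (_⊆ w) (sym (trans (map-tabulate pair proj₁) (tabulate-lookup s))) s⊆w ,
  trans (map-tabulate pair proj₂) (tabulate-lookup-cast p eq) ,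
  aligned
  where
  pair : Fin (length s) → ℕ × ℕ
  pair i = lookup s i , lookup p (cast eq i)

  tabulate-lookup-cast : ∀ p {n} (eq : n ≡ length p) →
    tabulate (λ i → lookup p (cast eq i)) ≡ p
  tabulate-lookup-cast p refl =
    trans (tabulate-cong (λ i → cong (lookup p) (cast-is-id refl i))) (tabulate-lookup p)

  aligned : Aligned (tabulate pair)
  aligned a∈ b∈ with i , refl ← ∈-tabulate⁻ a∈ | j , refl ← ∈-tabulate⁻ b∈ = iso i j

occurs⇒contains : ∀ {w p} → Occurs w p → Contains w p
occurs⇒contains (zs , zs⊆w , refl , aligned) =
  map proj₁ zs , zs⊆w , eq , λ i j → aligned (lookup-∈ zs eq i) (lookup-∈ zs eq j)
  where
  eq : length (map proj₁ zs) ≡ length (map proj₂ zs)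
  eq = trans (length-map proj₁ zs) (sym (length-map proj₂ zs))

  lookup-∈ : ∀ zs (eq : length (map proj₁ zs) ≡ length (map proj₂ zs)) i →
    (lookup (map proj₁ zs) i , lookup (map proj₂ zs) (cast eq i)) ∈ zs
  lookup-∈ (z ∷ zs) eq zero    = here refl
  lookup-∈ (z ∷ zs) eq (suc i) = there (lookup-∈ zs (suc-injective eq) i)

aligned-⊆ : ∀ {zs ys} → (∀ {z} → z ∈ zs → z ∈ ys) → Aligned ys → Aligned zs
aligned-⊆ zs⊆ys aligned a∈ b∈ = aligned (zs⊆ys a∈) (zs⊆ys b∈)

aligned-∷ : ∀ {x y zs} → (∀ {z} → z ∈ zs → x < proj₁ z × y < proj₂ z) →
  Aligned zs → Aligned ((x , y) ∷ zs)
aligned-∷ below aligned (here refl) (here refl) =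
  mk⇔ (λ lt → contradiction lt (<-irrefl refl)) (λ lt → contradiction lt (<-irrefl refl))
aligned-∷ below aligned (here refl) (there b∈)  =
  mk⇔ (λ _ → proj₂ (below b∈)) (λ _ → proj₁ (below b∈))
aligned-∷ below aligned (there a∈)  (here refl) =
  mk⇔ (λ lt → contradiction lt (<⇒≯ (proj₁ (below a∈))))
      (λ lt → contradiction lt (<⇒≯ (proj₂ (below a∈))))
aligned-∷ below aligned (there a∈)  (there b∈)  = aligned a∈ b∈

⊆-map⁻ : ∀ {A B : Set} (f : A → B) {ys} xs → ys ⊆ map f xs → ∃[ zs ] zs ⊆ xs × ys ≡ map f zs
⊆-map⁻ f []       []       = [] , [] , refl
⊆-map⁻ f (x ∷ xs) (_ ∷ʳ p) with zs , q , eq ← ⊆-map⁻ f xs p = zs , x ∷ʳ q , eq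
⊆-map⁻ f (x ∷ xs) (refl ∷ p) with zs , q , eq ← ⊆-map⁻ f xs p = x ∷ zs , refl ∷ q , cong (f x ∷_) eq

occurs-text : ∀ {w w′ p} → w ⊆ w′ → Occurs w p → Occurs w′ p
occurs-text w⊆w′ (zs , zs⊆w , rest) = zs , ⊆-trans zs⊆w w⊆w′ , rest

occurs-pattern : ∀ {w p p′} → p′ ⊆ p → Occurs w p → Occurs w p′
occurs-pattern p′⊆p (zs , zs⊆w , refl , aligned)
  with zs′ , zs′⊆zs , refl ← ⊆-map⁻ proj₂ zs p′⊆p =
  zs′ , ⊆-trans (Sublist.map⁺ proj₁ zs′⊆zs) zs⊆w , refl , aligned-⊆ (⊆-lookup zs′⊆zs) aligned

map-shift⁻ : ∀ k l w p zs → map proj₁ zs ⊆ map (k +_) w → map proj₂ zs ≡ map (l +_) p →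
  ∃[ zs′ ] zs ≡ map (Product.map (k +_) (l +_)) zs′ × map proj₁ zs′ ⊆ w × map proj₂ zs′ ≡ p
map-shift⁻ k l w       []      []       _          _  = [] , refl , minimum w , refl
map-shift⁻ k l (x ∷ w) p       (z ∷ zs) (_ ∷ʳ s)   eq
  with zs′ , eq₁ , s′ , eq₂ ← map-shift⁻ k l w p (z ∷ zs) s eq = zs′ , eq₁ , x ∷ʳ s′ , eq₂
map-shift⁻ k l (x ∷ w) (y ∷ p) (z ∷ zs) (refl ∷ s) eq
  with refl ← ∷-injectiveˡ eq
  with zs′ , refl , s′ , refl ← map-shift⁻ k l w p zs s (∷-injectiveʳ eq) =
  (x , y) ∷ zs′ , refl , refl ∷ s′ , refl

-- The two shifts are independent because `Aligned` compares text letters only with text letters and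
-- pattern letters only with pattern letters. Taking one shift to be 0 moves the other side alone.
occurs-shift⁺ : ∀ k l {w p} → Occurs w p → Occurs (map (k +_) w) (map (l +_) p)
occurs-shift⁺ k l (zs , zs⊆w , refl , aligned) =
  map shift zs ,
  subst (_⊆ _) (trans (sym (map-∘ zs)) (map-∘ zs)) (Sublist.map⁺ (k +_) zs⊆w) ,
  trans (sym (map-∘ zs)) (map-∘ zs) ,
  aligned′
  where
  shift : ℕ × ℕ → ℕ × ℕ
  shift = Product.map (k +_) (l +_)

  aligned′ : Aligned (map shift zs)
  aligned′ a∈ b∈ with a , a∈ , refl ← ∈-map⁻ shift a∈ | b , b∈ , refl ← ∈-map⁻ shift b∈ =
    mk⇔ (+-monoʳ-< l ∘ to   (aligned a∈ b∈) ∘ +-cancelˡ-< k _ _)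
        (+-monoʳ-< k ∘ from (aligned a∈ b∈) ∘ +-cancelˡ-< l _ _)

occurs-shift⁻ : ∀ k l {w p} → Occurs (map (k +_) w) (map (l +_) p) → Occurs w p
occurs-shift⁻ k l {w} {p} (zs , zs⊆w , eq , aligned)
  with zs′ , refl , zs′⊆w , eq′ ← map-shift⁻ k l w p zs zs⊆w eq =
  zs′ , zs′⊆w , eq′ , λ a∈ b∈ → let iso = aligned (∈-map⁺ _ a∈) (∈-map⁺ _ b∈) in
    mk⇔ (+-cancelˡ-< l _ _ ∘ to   iso ∘ +-monoʳ-< k)
        (+-cancelˡ-< k _ _ ∘ from iso ∘ +-monoʳ-< l)

map-⊆-++⁻ : ∀ {A B : Set} (f : A → B) w₁ {w₂} zs → map f zs ⊆ w₁ ++ w₂ →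
  ∃[ zs₁ ] ∃[ zs₂ ] zs ≡ zs₁ ++ zs₂ × map f zs₁ ⊆ w₁ × map f zs₂ ⊆ w₂
map-⊆-++⁻ f []       zs       s = [] , zs , refl , [] , s
map-⊆-++⁻ f (x ∷ w₁) []       s = [] , [] , refl , minimum _ , minimum _
map-⊆-++⁻ f (x ∷ w₁) (z ∷ zs) (_ ∷ʳ s)
  with zs₁ , zs₂ , eq , s₁ , s₂ ← map-⊆-++⁻ f w₁ (z ∷ zs) s = zs₁ , zs₂ , eq , x ∷ʳ s₁ , s₂
map-⊆-++⁻ f (x ∷ w₁) (z ∷ zs) (x≡ ∷ s)
  with zs₁ , zs₂ , eq , s₁ , s₂ ← map-⊆-++⁻ f w₁ zs s =
  z ∷ zs₁ , zs₂ , cong (z ∷_) eq , x≡ ∷ s₁ , s₂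

-- Cutting the text cuts the pattern. The last component keeps the comparisons across the cut, which
-- the two separate occurrences forget.
occurs-++⁻ : ∀ w₁ {w₂ p} → Occurs (w₁ ++ w₂) p →
  ∃[ p₁ ] ∃[ p₂ ] p ≡ p₁ ++ p₂ × Occurs w₁ p₁ × Occurs w₂ p₂ ×
  (∀ {x y} → x ∈ p₁ → y ∈ p₂ → ∃[ a ] ∃[ b ] a ∈ w₁ × b ∈ w₂ × (a < b ⇔ x < y))
occurs-++⁻ w₁ (zs , zs⊆ , refl , aligned)
  with zs₁ , zs₂ , refl , s₁ , s₂ ← map-⊆-++⁻ proj₁ w₁ zs zs⊆ =
  map proj₂ zs₁ , map proj₂ zs₂ , map-++ proj₂ zs₁ zs₂ ,
  (zs₁ , s₁ , refl , aligned-⊆ ∈-++⁺ˡ aligned) ,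
  (zs₂ , s₂ , refl , aligned-⊆ (∈-++⁺ʳ zs₁) aligned) ,
  λ x∈ y∈ → let a , a∈ , x≡ = ∈-map⁻ proj₂ x∈
                b , b∈ , y≡ = ∈-map⁻ proj₂ y∈
            in proj₁ a , proj₁ b , ⊆-lookup s₁ (∈-map⁺ proj₁ a∈) , ⊆-lookup s₂ (∈-map⁺ proj₁ b∈) ,
               subst₂ (λ x y → proj₁ a < proj₁ b ⇔ x < y) (sym x≡) (sym y≡)
                 (aligned (∈-++⁺ˡ a∈) (∈-++⁺ʳ zs₁ b∈))

-- Joining two partitions at the last 1

join : Word → Word → Word
join u π = (u ++ 𝟏) ⟦ π ⟧

join-partition : ∀ {u π} → IsPartition u → IsPartition π → IsPartition (join u π)
join-partition g h = ⟦⟧-partition (++𝟏-partition g) h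

length-join : ∀ u π → length (join u π) ≡ suc (length u + length π)
length-join u π = begin
  length ((u ++ 𝟏) ++ map (symbols (u ++ 𝟏) +_) π)          ≡⟨ length-++ (u ++ 𝟏) ⟩
  length (u ++ 𝟏) + length (map (symbols (u ++ 𝟏) +_) π)    ≡⟨ cong₂ _+_ (length-++ u) (length-map _ π) ⟩
  length u + 1 + length π                                    ≡⟨ cong (_+ length π) (+-comm (length u) 1) ⟩
  suc (length u + length π)                                  ∎
  where open ≡-Reasoning

1≤symbols-++𝟏 : ∀ {u} → IsPartition u → 1 ≤ symbols (u ++ 𝟏)
1≤symbols-++𝟏 {u} g = ∈⇒≤symbols (++𝟏-partition g) (∈-++⁺ʳ u (here refl))

symbols<shifted : ∀ k {π x} → IsPartition π → x ∈ map (k +_) π → k < x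
symbols<shifted k h x∈ with z , z∈ , refl ← ∈-map⁻ (k +_) x∈ =
  ≤-trans (≤-reflexive (sym (+-comm k 1))) (+-monoʳ-≤ k (growth-positive h z∈))

1∉shifted : ∀ {u π} → IsPartition u → IsPartition π → 1 ∉ map (symbols (u ++ 𝟏) +_) π
1∉shifted g h 1∈ = <⇒≱ (symbols<shifted _ h 1∈) (1≤symbols-++𝟏 g)

last-occurrence : ∀ {x : ℕ} {w} → x ∈ w → ∃[ u ] ∃[ v ] w ≡ (u ++ [ x ]) ++ v × x ∉ v
last-occurrence {x} {y ∷ w} x∈ with x ∈? w
... | yes x∈w with u , v , refl , x∉v ← last-occurrence x∈w = y ∷ u , v , refl , x∉v
last-occurrence (here refl) | no x∉w = [] , _ , refl , x∉w
last-occurrence (there x∈w) | no x∉w = contradiction x∈w x∉w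

-- If one of the prefixes were longer, its closing `x` would lie in the tail of the other
-- decomposition, which has none.
last-occurrence-unique : ∀ {x : ℕ} u u′ {v v′} → x ∉ v → x ∉ v′ →
  (u ++ [ x ]) ++ v ≡ (u′ ++ [ x ]) ++ v′ → u ≡ u′ × v ≡ v′
last-occurrence-unique []      []       x∉v x∉v′ eq = refl , ∷-injectiveʳ eq
last-occurrence-unique []      (y ∷ u′) x∉v x∉v′ eq =
  contradiction (subst (_ ∈_) (sym (∷-injectiveʳ eq)) (∈-++⁺ˡ (∈-++⁺ʳ u′ (here refl)))) x∉v
last-occurrence-unique (y ∷ u) []       x∉v x∉v′ eq =
  contradiction (subst (_ ∈_) (∷-injectiveʳ eq) (∈-++⁺ˡ (∈-++⁺ʳ u (here refl)))) x∉v′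
last-occurrence-unique (y ∷ u) (z ∷ u′) x∉v x∉v′ eq =
  Product.map₁ (cong₂ _∷_ (∷-injectiveˡ eq))
    (last-occurrence-unique u u′ x∉v x∉v′ (∷-injectiveʳ eq))

join-injective : ∀ {u π u′ π′} → IsPartition u → IsPartition π → IsPartition u′ → IsPartition π′ →
  join u π ≡ join u′ π′ → u ≡ u′ × π ≡ π′
join-injective {u} {π} {u′} g h g′ h′ eq
  with refl , eq′ ← last-occurrence-unique u u′ (1∉shifted g h) (1∉shifted g′ h′) eq =
  refl , map-injective (+-cancelˡ-≡ _ _ _) eq′

1212ₚ : Word
1212ₚ = 1 ∷ 2 ∷ 1 ∷ 2 ∷ []

xyxy-crossing : ∀ {x y} → x < y → Occurs (x ∷ y ∷ x ∷ y ∷ []) 1212ₚ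
xyxy-crossing {x} {y} x<y =
  (x , 1) ∷ (y , 2) ∷ (x , 1) ∷ (y , 2) ∷ [] , ⊆-refl , refl ,
  -- The four pairs are two pairs repeated, so alignment is checked on those two only.
  aligned-⊆ reduce (aligned-∷ {x} {1} {(y , 2) ∷ []} (λ { (here refl) → x<y , s≤s (s≤s z≤n) })
    (aligned-∷ (λ ()) (λ ())))
  where
  reduce : ∀ {z} → z ∈ (x , 1) ∷ (y , 2) ∷ (x , 1) ∷ (y , 2) ∷ [] → z ∈ (x , 1) ∷ (y , 2) ∷ []
  reduce (here eq)                         = here eq
  reduce (there (here eq))                 = there (here eq)
  reduce (there (there (here eq)))         = here eq
  reduce (there (there (there (here eq)))) = there (here eq)

-- A nonempty partition starts with 1, so every other letter has this 1 before it.
1x⊆partition : ∀ {u x} → IsPartition u → x ∈ u → x ≢ 1 → 1 ∷ x ∷ [] ⊆ u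
1x⊆partition ((1≤y , y≤1) ∷ _) (here refl) x≢1 = contradiction (≤-antisym y≤1 1≤y) x≢1
1x⊆partition ((1≤y , y≤1) ∷ _) (there x∈)  x≢1 = ≤-antisym 1≤y y≤1 ∷ from∈ x∈

-- A letter x ≤ symbols (u ++ 𝟏) after the last 1 would already occur in u, giving 1 x 1 x.
symbols<after-last-1 : ∀ u {v x} → IsPartition ((u ++ 𝟏) ++ v) → NonCrossing ((u ++ 𝟏) ++ v) →
  1 ∉ v → x ∈ v → symbols (u ++ 𝟏) < x
symbols<after-last-1 u {v} {x} g nc 1∉v x∈v = ≰⇒> λ x≤ →
  let gu1 = proj₁ (partition-++⁻ (u ++ 𝟏) g)
      1≤x = growth-positive g (∈-++⁺ʳ (u ++ 𝟏) x∈v)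
      x≢1 = λ x≡1 → 1∉v (subst (_∈ v) x≡1 x∈v)
      x∈u = Sum.fromInj₁ (λ { (here x≡1) → contradiction x≡1 x≢1 })
              (∈-++⁻ u (≤symbols⇒∈ gu1 1≤x x≤))
      1x⊆ = 1x⊆partition (proj₁ (partition-++⁻ u gu1)) x∈u x≢1
  in nc (occurs⇒contains (occurs-text
       (Sublist.++⁺ (Sublist.++⁺ 1x⊆ (⊆-refl {x = 𝟏})) (from∈ x∈v))
       (xyxy-crossing (≤∧≢⇒< 1≤x (x≢1 ∘ sym)))))

1∈partition : ∀ {w} → IsPartition w → w ≢ [] → 1 ∈ w
1∈partition []                  w≢[] = contradiction refl w≢[]
1∈partition ((1≤x , x≤1) ∷ _) w≢[] = here (≤-antisym 1≤x x≤1)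

-- Everything after the last 1 exceeds `symbols (u ++ 𝟏)`, hence the tail is a shifted partition.
unjoin : ∀ {w} → IsPartition w → NonCrossing w → w ≢ [] →
  ∃[ u ] ∃[ π ] IsPartition u × IsPartition π × w ≡ join u π
unjoin g nc w≢[]
  with u , v , refl , 1∉v ← last-occurrence (1∈partition g w≢[])
  with gu1 , gv ← partition-++⁻ (u ++ 𝟏) g
  with π , h , refl ← partition-unshift (symbols (u ++ 𝟏)) gv (symbols<after-last-1 u g nc 1∉v)
  = u , π , proj₁ (partition-++⁻ u gu1) , h , refl

-- Patterns in a join

occurs-join⁺ˡ : ∀ {u π p} → Occurs (u ++ 𝟏) p → Occurs (join u π) p
occurs-join⁺ˡ = occurs-text (Sublist.++⁺ʳ _ ⊆-refl)

occurs-join⁺ʳ : ∀ {u π p} → Occurs π p → Occurs (join u π) p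
occurs-join⁺ʳ {u} {π} {p} o = occurs-text (Sublist.++⁺ˡ (u ++ 𝟏) ⊆-refl)
  (subst (Occurs _) (map-id p) (occurs-shift⁺ (symbols (u ++ 𝟏)) 0 o))

occurs-++𝟏 : ∀ {u p} → Occurs u p → Occurs (u ++ 𝟏) p
occurs-++𝟏 = occurs-text (Sublist.++⁺ʳ 𝟏 ⊆-refl)

-- Every letter of the shifted `π` exceeds every letter of `u ++ 𝟏`, and the pattern inherits this
-- strict inequality across its cut.
occurs-join⁻ : ∀ {u π p} → IsPartition u → IsPartition π → Occurs (join u π) p →
  ∃[ p₁ ] ∃[ p₂ ] p ≡ p₁ ++ p₂ × Occurs (u ++ 𝟏) p₁ × Occurs π p₂ ×
  (∀ {x y} → x ∈ p₁ → y ∈ p₂ → x < y)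
occurs-join⁻ {u} {π} g h o
  with p₁ , p₂ , eq , o₁ , o₂ , iso ← occurs-++⁻ (u ++ 𝟏) o =
  p₁ , p₂ , eq , o₁ ,
  occurs-shift⁻ (symbols (u ++ 𝟏)) 0 (subst (Occurs _) (sym (map-id p₂)) o₂) ,
  λ x∈ y∈ → let a , b , a∈ , b∈ , a<b⇔x<y = iso x∈ y∈ in
    to a<b⇔x<y (≤-<-trans (∈⇒≤symbols (++𝟏-partition g) a∈) (symbols<shifted _ h b∈))

occurs-[x]⁻ : ∀ {x p} → Occurs [ x ] p → p ≡ [] ⊎ ∃[ y ] p ≡ [ y ]
occurs-[x]⁻ ([]        , _           , refl , _) = inj₁ refl
occurs-[x]⁻ (_ ∷ []    , _           , refl , _) = inj₂ (_ , refl)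
occurs-[x]⁻ (_ ∷ _ ∷ _ , (_ ∷ ())    , _)
occurs-[x]⁻ (_ ∷ _ ∷ _ , (_ ∷ʳ ())   , _)

-- If the final 1 takes part in an occurrence, it is the image of a minimal letter.
occurs-++𝟏⁻ : ∀ {u p} → IsPartition u → Occurs (u ++ 𝟏) p →
  Occurs u p ⊎ ∃[ p′ ] ∃[ y ] p ≡ p′ ++ [ y ] × Occurs u p′ × (∀ {x} → x ∈ p′ → y ≤ x)
occurs-++𝟏⁻ {u} g o with p₁ , p₂ , refl , o₁ , o₂ , iso ← occurs-++⁻ u o with occurs-[x]⁻ o₂
... | inj₁ refl       = inj₁ (subst (Occurs u) (sym (++-identityʳ p₁)) o₁)
... | inj₂ (y , refl) = inj₂ (p₁ , y , refl , o₁ , λ x∈ → ≮⇒≥ λ x<y → minimal x∈ x<y)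
  where
  minimal : ∀ {x} → x ∈ p₁ → ¬ x < y
  minimal x∈ x<y with iso x∈ (here refl)
  ... | a , _ , a∈ , here refl , a<b⇔x<y = <⇒≱ (from a<b⇔x<y x<y) (growth-positive g a∈)

-- The patterns `p` and `q` may differ from `r`, so that a single recurrence covers both families.
-- The instances (`r`; `p`, `q`) are (1212; 1212, 1212), (1[ρ]1; 1[ρ], 1[ρ]1) and (1[σ]; 1[σ], σ).
SplitsAtJoin : Word → Word → Word → Set
SplitsAtJoin r p q = ∀ {u π} → IsPartition u → IsPartition π →
  Occurs (join u π) r ⇔ (Occurs u p ⊎ Occurs π q)

-- Every proper cut of 1212 leaves some letter on both sides, against the strict inequality across
-- the cut. An occurrence in `u ++ 𝟏` cannot use the final 1, since the closing 2 is not minimal.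
splits-1212 : SplitsAtJoin 1212ₚ 1212ₚ 1212ₚ
splits-1212 {u} {π} g h = mk⇔ split Sum.[ occurs-join⁺ˡ ∘ occurs-++𝟏 , occurs-join⁺ʳ {u} ]
  where
  split : Occurs (join u π) 1212ₚ → Occurs u 1212ₚ ⊎ Occurs π 1212ₚ
  split o with occurs-join⁻ g h o
  ... | []              , _ , refl , _  , o₂ , _     = inj₂ o₂
  ... | _ ∷ []          , _ , refl , _  , _  , below =
    contradiction (below (here refl) (there (here refl))) (<-irrefl refl)
  ... | _ ∷ _ ∷ []      , _ , refl , _  , _  , below =
    contradiction (below (here refl) (here refl)) (<-irrefl refl)
  ... | _ ∷ _ ∷ _ ∷ []  , _ , refl , _  , _  , below =
    contradiction (below (there (here refl)) (here refl)) (<-irrefl refl)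
  ... | _ ∷ _ ∷ _ ∷ _ ∷ _ ∷ _ , _ , () , _
  ... | _ ∷ _ ∷ _ ∷ _ ∷ [] , _ , refl , o₁ , _ , _ with occurs-++𝟏⁻ g o₁
  ...   | inj₁ o = inj₁ o
  ...   | inj₂ (p′ , y , eq , _ , minimal)
    with refl , refl ← ∷ʳ-injective (1 ∷ 2 ∷ 1 ∷ []) p′ eq
    with s≤s () ← minimal (here refl)

-- The pattern begins and ends with 1, so a proper cut would put 1 on both sides. An occurrence
-- therefore lies in `π` or in `u ++ 𝟏`; in the latter case, deleting its last letter leaves 1[ρ]
-- inside `u`. Conversely, the 1 after `u` closes an occurrence of 1[ρ].
splits-ends : ∀ {ρ} → IsPartition ρ → SplitsAtJoin (𝟏 ⟦ ρ ⟧ ++ 𝟏) (𝟏 ⟦ ρ ⟧) (𝟏 ⟦ ρ ⟧ ++ 𝟏)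
splits-ends {ρ} k {u} {π} g h =
  mk⇔ split Sum.[ occurs-join⁺ˡ ∘ close g , occurs-join⁺ʳ {u} ]
  where
  -- The first letter of an occurrence of 1[ρ] may be replaced by the leading 1 of u.
  close : ∀ {u} → IsPartition u → Occurs u (𝟏 ⟦ ρ ⟧) → Occurs (u ++ 𝟏) (𝟏 ⟦ ρ ⟧ ++ 𝟏)
  close {y ∷ u} g@((1≤y , y≤1) ∷ _) (z ∷ zs , zs⊆ , eq , aligned) =
    -- The closing pair repeats the opening one, so alignment reduces to placing (1 , 1) below `zs`.
    (1 , 1) ∷ zs ++ [ (1 , 1) ] ,
    subst (_⊆ y ∷ u ++ 𝟏) (cong (1 ∷_) (sym (map-++ proj₁ zs [ (1 , 1) ])))
      (≤-antisym 1≤y y≤1 ∷ Sublist.++⁺ (∷-⊆⁻ zs⊆) ⊆-refl) ,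
    cong (1 ∷_) (trans (map-++ proj₂ zs _) (cong (_++ 𝟏) (∷-injectiveʳ eq))) ,
    aligned-⊆ reduce (aligned-∷ below (aligned-⊆ there aligned))
    where
    ∷-⊆⁻ : ∀ {x y : ℕ} {xs ys} → x ∷ xs ⊆ y ∷ ys → xs ⊆ ys
    ∷-⊆⁻ (_ ∷ʳ s) = ⊆-trans (_ ∷ʳ ⊆-refl) s
    ∷-⊆⁻ (_ ∷ s)  = s

    reduce : ∀ {b} → b ∈ (1 , 1) ∷ zs ++ [ (1 , 1) ] → b ∈ (1 , 1) ∷ zs
    reduce (here e)   = here e
    reduce (there b∈) with ∈-++⁻ zs b∈
    ... | inj₁ b∈zs     = there b∈zs
    ... | inj₂ (here e) = here e

    below : ∀ {b} → b ∈ zs → 1 < proj₁ b × 1 < proj₂ b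
    below b∈ =
      let 1<b₂ = symbols<shifted 1 k (subst (_ ∈_) (∷-injectiveʳ eq) (∈-map⁺ proj₂ b∈))
          z<b  = from (aligned (here refl) (there b∈))
                   (subst (_< _) (sym (∷-injectiveˡ eq)) 1<b₂)
      in ≤-<-trans (growth-positive g (⊆-lookup zs⊆ (here refl))) z<b , 1<b₂
  close [] ([] , _ , () , _)
  close (_ ∷ _) ([] , _ , () , _)

  split : Occurs (join u π) (𝟏 ⟦ ρ ⟧ ++ 𝟏) → Occurs u (𝟏 ⟦ ρ ⟧) ⊎ Occurs π (𝟏 ⟦ ρ ⟧ ++ 𝟏)
  split o with occurs-join⁻ g h o
  ... | []     , p₂ , refl , _  , o₂ , _ = inj₂ o₂
  ... | p₁@(_ ∷ _) , [] , eq , o₁ , _ , _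
    with occurs-++𝟏⁻ g (subst (Occurs _) (trans (sym (++-identityʳ p₁)) (sym eq)) o₁)
  ...   | inj₁ o = inj₁ (occurs-pattern (Sublist.++⁺ʳ 𝟏 ⊆-refl) o)
  ...   | inj₂ (p′ , y , eq′ , o′ , _) = inj₁ (subst (Occurs u) (sym (∷ʳ-injectiveˡ (𝟏 ⟦ ρ ⟧) p′ eq′)) o′)
  -- Both sides are nonempty: the leading 1 is on the left and the final 1 on the right.
  split o | x ∷ p₁ , y ∷ p₂ , eq , _ , _ , below with refl ← ∷-injectiveˡ eq =
    contradiction (below (here refl) (last∈ (map suc ρ) p₁ (∷-injectiveʳ eq))) (<-irrefl refl)
    where
    last∈ : ∀ q p {y} {p′ : Word} → q ++ 𝟏 ≡ p ++ y ∷ p′ → 1 ∈ y ∷ p′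
    last∈ q       []      eq = subst (1 ∈_) eq (∈-++⁺ʳ q (here refl))
    last∈ (_ ∷ q) (_ ∷ p) eq = last∈ q p (∷-injectiveʳ eq)
    last∈ []      (_ ∷ []) ()
    last∈ []      (_ ∷ _ ∷ _) ()

map-++⁻ : ∀ {A B : Set} (f : A → B) xs ys {zs} → map f xs ≡ ys ++ zs →
  ∃[ ys′ ] ∃[ zs′ ] xs ≡ ys′ ++ zs′ × ys ≡ map f ys′ × zs ≡ map f zs′
map-++⁻ f xs       []       eq = [] , xs , refl , refl , sym eq
map-++⁻ f (x ∷ xs) (y ∷ ys) eq
  with ys′ , zs′ , eq₁ , eq₂ , eq₃ ← map-++⁻ f xs ys (∷-injectiveʳ eq) =
  x ∷ ys′ , zs′ , cong (x ∷_) eq₁ , cong₂ _∷_ (sym (∷-injectiveˡ eq)) eq₂ , eq₃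

-- If both parts were nonempty, `α` would be a partition and `β` a partition shifted by the number
-- of blocks of `α`, contradicting connectedness.
connected-split : ∀ {σ} → IsPartition σ → Connected σ → ∀ α β → σ ≡ α ++ β →
  (∀ {x y} → x ∈ α → y ∈ β → x < y) → α ≡ [] ⊎ β ≡ []
connected-split g c []        β       eq below = inj₁ refl
connected-split g c (_ ∷ _)   []      eq below = inj₂ refl
connected-split g c α@(x ∷ _) β@(_ ∷ _) refl below
  with gα , gβ ← partition-++⁻ α g
  with β′ , gβ′ , eq ← partition-unshift (symbols α) gβ
         -- As `α` is nonempty, `symbols α` is itself one of its letters, so `below` puts all of `β`
         -- above it.
         (below (≤symbols⇒∈ gα (≤-trans (growth-positive gα (here refl)) (∈⇒≤symbols gα (here refl))) ≤-refl))
  = contradiction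
      (α , β′ , gα , gβ′ , (λ ()) , (λ { refl → contradiction eq λ () }) , cong (α ++_) eq) c

-- A cut of 1[σ] after its leading 1 divides σ into a lower part followed by a higher one, so
-- connectedness leaves σ whole on one side. If that side is `u ++ 𝟏`, the final 1 cannot match the
-- last letter of a nonempty shifted σ, which exceeds the leading 1.
splits-connected : ∀ {σ} → IsPartition σ → Connected σ → SplitsAtJoin (𝟏 ⟦ σ ⟧) (𝟏 ⟦ σ ⟧) σ
splits-connected {σ} k c {u} {π} g h =
  mk⇔ split Sum.[ occurs-join⁺ˡ ∘ occurs-++𝟏 , prefix ]
  where
  -- The 1 between u and π serves as the leading letter of 1[σ].
  prefix : Occurs π σ → Occurs (join u π) (𝟏 ⟦ σ ⟧)
  prefix o with zs , zs⊆ , eq , aligned ← occurs-shift⁺ (symbols (u ++ 𝟏)) 1 o =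
    (1 , 1) ∷ zs ,
    Sublist.++⁺ (Sublist.++⁺ˡ u (⊆-refl {x = 𝟏})) zs⊆ ,
    cong (1 ∷_) eq ,
    aligned-∷ (λ z∈ →
        ≤-<-trans (1≤symbols-++𝟏 g) (symbols<shifted _ h (⊆-lookup zs⊆ (∈-map⁺ proj₁ z∈))) ,
        symbols<shifted 1 k (subst (_ ∈_) eq (∈-map⁺ proj₂ z∈)))
      aligned

  unsuc : Occurs π (map suc σ) → Occurs π σ
  unsuc o = occurs-shift⁻ 0 1 (subst (λ w → Occurs w (map suc σ)) (sym (map-id π)) o)

  split : Occurs (join u π) (𝟏 ⟦ σ ⟧) → Occurs u (𝟏 ⟦ σ ⟧) ⊎ Occurs π σ
  split o with occurs-join⁻ g h o
  ... | [] , p₂ , refl , _ , o₂ , _ = inj₂ (unsuc (occurs-pattern (1 ∷ʳ ⊆-refl) o₂))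
  ... | x ∷ p₁ , p₂ , eq , o₁ , o₂ , below
    with α , β , refl , refl , refl ← map-++⁻ suc σ p₁ (∷-injectiveʳ eq)
    with connected-split k c α β refl
           (λ a∈ b∈ → s<s⁻¹ (below (there (∈-map⁺ suc a∈)) (∈-map⁺ suc b∈)))
  ...   | inj₁ refl = inj₂ (unsuc o₂)
  ...   | inj₂ refl with occurs-++𝟏⁻ g
            (subst (Occurs _) (cong₂ _∷_ (sym (∷-injectiveˡ eq)) (cong (map suc) (sym (++-identityʳ α)))) o₁)
  ...     | inj₁ o = inj₁ o
  -- The pattern is a single letter, so σ is empty and occurs in `π` trivially.
  ...     | inj₂ ([]     , y , eq′ , _ , _) =
    inj₂ (unsuc (subst (Occurs π) (sym (∷-injectiveʳ eq′)) o₂))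
  ...     | inj₂ (z ∷ p′ , y , eq′ , _ , minimal) with refl ← ∷-injectiveˡ eq′ =
    contradiction (minimal (here refl))
      (<⇒≱ (symbols<shifted 1 k (subst (y ∈_) (sym (∷-injectiveʳ eq′)) (∈-++⁺ʳ p′ (here refl)))))

-- The recurrence for the numbers of avoiders

∈-ncAvoiders : ∀ n p {w} →
  w ∈ ncAvoiders n p ⇔ (IsPartition w × length w ≡ n × NonCrossing w × Avoids w p)
∈-ncAvoiders n p = mk⇔
  (λ w∈ → let w∈n , nc , av = ∈-filter⁻ avoider? w∈
              g , len = to ∈-partitions w∈n
          in g , len , nc , av)
  (λ (g , len , nc , av) → ∈-filter⁺ avoider? (from ∈-partitions (g , len)) (nc , av))
  where
  avoider? = λ w → nonCrossing? w ×-dec avoids? w p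

ncAvoiders-unique : ∀ n p → Unique (ncAvoiders n p)
ncAvoiders-unique n p = Unique.filter⁺ _ (partitions-unique n)

avoids-join : ∀ {r p q} → SplitsAtJoin r p q → ∀ {u π} → IsPartition u → IsPartition π →
  Avoids (join u π) r ⇔ (Avoids u p × Avoids π q)
avoids-join splits g h = mk⇔
  (λ av → (λ o → av (occurs⇒contains (from (splits g h) (inj₁ (contains⇒occurs o)))))
        , (λ o → av (occurs⇒contains (from (splits g h) (inj₂ (contains⇒occurs o))))))
  (λ (av₁ , av₂) o → Sum.[ av₁ ∘ occurs⇒contains , av₂ ∘ occurs⇒contains ]
    (to (splits g h) (contains⇒occurs o)))

avoiderPairsAt : ℕ → Word → Word → ℕ → List (Word × Word)
avoiderPairsAt n p q i = cartesianProduct (ncAvoiders i p) (ncAvoiders (n ∸ i) q)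

-- Slicing by the length of the first word gives the terms of the convolution. The slices are
-- disjoint because that length can be read off the pair.
avoiderPairs : ℕ → Word → Word → List (Word × Word)
avoiderPairs n p q = concatMap (avoiderPairsAt n p q) (upTo (suc n))

∈-avoiderPairs⁺ : ∀ {p q u π} n → length u + length π ≡ n →
  u ∈ ncAvoiders (length u) p → π ∈ ncAvoiders (length π) q → (u , π) ∈ avoiderPairs n p q
∈-avoiderPairs⁺ {p} {q} {u} {π} n refl u∈ π∈ =
  ∈-concatMap⁺ (avoiderPairsAt n p q) (lose (∈-upTo⁺ (s≤s (m≤m+n (length u) (length π))))
    (∈-cartesianProduct⁺ u∈
      (subst (λ j → π ∈ ncAvoiders j q) (sym (m+n∸m≡n (length u) (length π))) π∈)))

∈-avoiderPairs⁻ : ∀ {p q u π} n → (u , π) ∈ avoiderPairs n p q →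
  ∃[ i ] i ≤ n × u ∈ ncAvoiders i p × π ∈ ncAvoiders (n ∸ i) q
∈-avoiderPairs⁻ {p} {q} n up∈
  with i , i∈ , up∈i ← find (∈-concatMap⁻ (avoiderPairsAt n p q) {xs = upTo (suc n)} up∈)
  = i , s≤s⁻¹ (∈-upTo⁻ i∈) , ∈-cartesianProduct⁻ (ncAvoiders i p) (ncAvoiders (n ∸ i) q) up∈i

avoiderPairs-partitions : ∀ {p q u π} n → (u , π) ∈ avoiderPairs n p q →
  IsPartition u × IsPartition π
avoiderPairs-partitions {p} {q} n up∈ with i , _ , u∈ , π∈ ← ∈-avoiderPairs⁻ n up∈ =
  proj₁ (to (∈-ncAvoiders i p) u∈) , proj₁ (to (∈-ncAvoiders (n ∸ i) q) π∈)

avoiderPairs-unique : ∀ n p q → Unique (avoiderPairs n p q)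
avoiderPairs-unique n p q = Unique.concat⁺
  (All.map⁺ (universal fibre! (upTo (suc n))))
  (AllPairs.map⁺ {f = avoiderPairsAt n p q}
    (AllPairs.map (λ {i} {j} → disjoint {i} {j}) (Unique.upTo⁺ (suc n))))
  where
  fibre! : ∀ i → Unique (avoiderPairsAt n p q i)
  fibre! i = Unique.cartesianProduct⁺ (ncAvoiders-unique i p) (ncAvoiders-unique (n ∸ i) q)

  length-proj₁ : ∀ {i up} → up ∈ avoiderPairsAt n p q i →
    length (proj₁ up) ≡ i
  length-proj₁ {i} up∈ =
    proj₁ (proj₂ (to (∈-ncAvoiders i p) (proj₁ (∈-cartesianProduct⁻ (ncAvoiders i p) _ up∈))))

  disjoint : ∀ {i j} → i ≢ j →
    Disjoint (avoiderPairsAt n p q i) (avoiderPairsAt n p q j)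
  disjoint {i} {j} i≢j (∈i , ∈j) = i≢j (trans (sym (length-proj₁ {i} ∈i)) (length-proj₁ {j} ∈j))

length-avoiderPairs : ∀ n p q → length (avoiderPairs n p q) ≡
  sum (map (λ i → length (ncAvoiders i p) * length (ncAvoiders (n ∸ i) q)) (upTo (suc n)))
length-avoiderPairs n p q = trans (length-concatMap (avoiderPairsAt n p q) (upTo (suc n)))
  (cong sum (map-cong (λ i → length-cartesianProduct (ncAvoiders i p) (ncAvoiders (n ∸ i) q))
                      (upTo (suc n))))

-- `join` is a bijection from the pairs of total length `n` onto the avoiders of length `suc n`; the
-- extra letter is the 1 at the cut.
ncAvoiders-recurrence : ∀ {r p q} → SplitsAtJoin r p q → ∀ n → length (ncAvoiders (suc n) r) ≡
  sum (map (λ i → length (ncAvoiders i p) * length (ncAvoiders (n ∸ i) q)) (upTo (suc n)))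
ncAvoiders-recurrence {r} {p} {q} splits n = begin
  length (ncAvoiders (suc n) r)
    ≡⟨ Unique∧⇔⇒length≡ (ncAvoiders-unique (suc n) r) joins! (mk⇔ decompose compose) ⟩
  length (map (uncurry join) (avoiderPairs n p q))
    ≡⟨ length-map _ (avoiderPairs n p q) ⟩
  length (avoiderPairs n p q)
    ≡⟨ length-avoiderPairs n p q ⟩
  sum (map (λ i → length (ncAvoiders i p) * length (ncAvoiders (n ∸ i) q)) (upTo (suc n))) ∎
  where
  open ≡-Reasoning

  joins! : Unique (map (uncurry join) (avoiderPairs n p q))
  joins! = Unique-map
    (λ x∈ y∈ eq → let g , h   = avoiderPairs-partitions n x∈
                      g′ , h′ = avoiderPairs-partitions n y∈
                      eq₁ , eq₂ = join-injective g h g′ h′ eq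
                  in cong₂ _,_ eq₁ eq₂)
    (avoiderPairs-unique n p q)

  decompose : ∀ {w} → w ∈ ncAvoiders (suc n) r → w ∈ map (uncurry join) (avoiderPairs n p q)
  decompose w∈
    with g , len , nc , av ← to (∈-ncAvoiders (suc n) r) w∈
    with u , π , gu , gπ , refl ← unjoin g nc (λ { refl → contradiction len λ () })
    with nc₁ , nc₂ ← to (avoids-join splits-1212 gu gπ) nc
    with av₁ , av₂ ← to (avoids-join splits gu gπ) av
    = ∈-map⁺ (uncurry join) (∈-avoiderPairs⁺ n
        (suc-injective (trans (sym (length-join u π)) len))
        (from (∈-ncAvoiders (length u) p) (gu , refl , nc₁ , av₁))
        (from (∈-ncAvoiders (length π) q) (gπ , refl , nc₂ , av₂)))

  compose : ∀ {w} → w ∈ map (uncurry join) (avoiderPairs n p q) → w ∈ ncAvoiders (suc n) r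
  compose w∈
    with (u , π) , uπ∈ , refl ← ∈-map⁻ (uncurry join) w∈
    with i , i≤n , u∈ , π∈ ← ∈-avoiderPairs⁻ n uπ∈
    with g , refl , nc₁ , av₁ ← to (∈-ncAvoiders i p) u∈
    with h , len , nc₂ , av₂ ← to (∈-ncAvoiders (n ∸ i) q) π∈
    = from (∈-ncAvoiders (suc n) r)
        ( join-partition g h
        , trans (length-join u π) (cong suc (trans (cong (length u +_) len) (m+[n∸m]≡n i≤n)))
        , from (avoids-join splits-1212 g h) (nc₁ , nc₂)
        , from (avoids-join splits g h) (av₁ , av₂))

-- Equality of the two counts by strong induction on the length

theorem3p8 : ∀ σ ρ →
    IsPartition σ → NonCrossing σ → Connected σ →
    IsPartition ρ → NonCrossing ρ →
    let τ = 𝟏 ⟦ ρ ⟧ in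
    NcEquivalent σ τ →
    NcEquivalent (𝟏 ⟦ σ ⟧) (τ ++ 𝟏)
theorem3p8 σ ρ σ-partition _ σ-connected ρ-partition _ σ~τ =
  <-rec (λ n → count (𝟏 ⟦ σ ⟧) n ≡ count (τ ++ 𝟏) n) step
  where
  τ = 𝟏 ⟦ ρ ⟧

  count : Word → ℕ → ℕ
  count p n = length (ncAvoiders n p)

  step : ∀ n → (∀ {m} → m < n → count (𝟏 ⟦ σ ⟧) m ≡ count (τ ++ 𝟏) m) →
    count (𝟏 ⟦ σ ⟧) n ≡ count (τ ++ 𝟏) n
  -- Both patterns are nonempty, so the empty partition avoids them and each count evaluates to 1.
  step zero    ih = refl
  step (suc n) ih = begin
    count (𝟏 ⟦ σ ⟧) (suc n)
      ≡⟨ ncAvoiders-recurrence (splits-connected σ-partition σ-connected) n ⟩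
    sum (map (λ i → count (𝟏 ⟦ σ ⟧) i * count σ (n ∸ i)) (upTo (suc n)))
      -- The term at `i` is matched with the term at `n ∸ i` of the other convolution; the induction
      -- hypothesis applies since `i` is at most `n`.
      ≡⟨ cong sum (map-cong-local (All.tabulate (termwise ∘ ∈-upTo⁻))) ⟩
    sum (map (λ i → count τ (n ∸ i) * count (τ ++ 𝟏) (n ∸ (n ∸ i))) (upTo (suc n)))
      ≡⟨ sum-upTo-reverse (λ i → count τ i * count (τ ++ 𝟏) (n ∸ i)) n ⟨
    sum (map (λ i → count τ i * count (τ ++ 𝟏) (n ∸ i)) (upTo (suc n)))
      ≡⟨ ncAvoiders-recurrence (splits-ends ρ-partition) n ⟨
    count (τ ++ 𝟏) (suc n) ∎
    where
    open ≡-Reasoning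

    termwise : ∀ {i} → i < suc n → count (𝟏 ⟦ σ ⟧) i * count σ (n ∸ i) ≡
      count τ (n ∸ i) * count (τ ++ 𝟏) (n ∸ (n ∸ i))
    termwise {i} i<1+n = begin
      count (𝟏 ⟦ σ ⟧) i * count σ (n ∸ i)
        ≡⟨ *-comm (count (𝟏 ⟦ σ ⟧) i) _ ⟩
      count σ (n ∸ i) * count (𝟏 ⟦ σ ⟧) i
        ≡⟨ cong₂ _*_ (σ~τ (n ∸ i)) (ih i<1+n) ⟩
      count τ (n ∸ i) * count (τ ++ 𝟏) i
        ≡⟨ cong (λ j → count τ (n ∸ i) * count (τ ++ 𝟏) j) (m∸[m∸n]≡n (s≤s⁻¹ i<1+n)) ⟨
      count τ (n ∸ i) * count (τ ++ 𝟏) (n ∸ (n ∸ i)) ∎
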